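{- Let $X_n$ be the number of correct guesses in the card guessing game with complete feedback after a single shelf shuffle of $n$ cards. Then $$\mathbb E(X_n)=\tfrac34\, n\quad\text{for all } n\ge 2,\qquad \mathbb E(X_1)=1,$$ and the variance satisfies $$\mathbb V(X_n)=\frac{n}{16}\quad\text{for all } n\ge 3,\qquad \mathbb V(X_1)=0,\quad \mathbb V(X_2)=\tfrac14 .$$
   Context: Single shelf shuffle: an ordered deck of $n$ cards labelled $1,\dots,n$ (card $1$ on top, card $n$ at the bottom) is given. Cards are drawn one by one from the bottom of the deck (so in the order $n,n-1,\dots,1$) and put on an initially empty pile; each drawn card is placed, independently, at the top or at the bottom of the pile with probability $1/2$ each. The final pile is the shuffled deck. Game: cards are drawn one after the other from the top of the shuffled deck. Before each draw the player guesses the label of the card; afterwards the card is shown (complete feedback). The player uses the following optimal strategy: the first guess is card $1$; as long as neither card $n-1$ nor card $n$ has been shown, the next guess is the label immediately following that of the most recently shown card; once one of the cards $n-1$ or $n$ has been shown, the player guesses the remaining (not yet shown) cards in descending order. $X_n$ denotes the total number of correct guesses. -}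

module Defs where

open import Data.Bool using (if_then_else_)
open import Data.Fin using (toℕ)
open import Data.Integer using (+_)
open import Data.List as List using (List; []; _∷_)
open import Data.List.Membership.DecPropositional using (_∈?_)
open import Data.Nat as ℕ using (ℕ; zero; suc; _∸_; _≟_)
open import Data.Product using (_,_)
open import Data.Rational using (ℚ; 0ℚ; ½; _+_; _-_; _*_; _/_; +-*-rawSemiring)
open import Data.Vec as Vec using (Vec; []; _∷_; _∷ʳ_)
open import Relation.Nullary using (does)
open import Relation.Nullary.Decidable using (_⊎-dec_)

open import Algebra.Definitions.RawSemiring +-*-rawSemiring using (_^_)

-- A deck lists its cards from top to bottom.
Card : Set
Card = ℕ

Deck : ℕ → Set
Deck = Vec Card

orderedDeck : ∀ n → Deck n
orderedDeck n = Vec.tabulate (λ i → suc (toℕ i))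

data Side : Set where
  top bottom : Side

place : ∀ {k} → Side → Card → Deck k → Deck (suc k)
place top    c pile = c ∷ pile
place bottom c pile = pile ∷ʳ c

-- foldr consumes the vector from its last entry to its first, so the cards
-- are drawn from the bottom of the deck.  The i-th side belongs to the i-th
-- card from the top of the deck.
shelfShuffle : ∀ {n} → Vec Side n → Deck n → Deck n
shelfShuffle sides deck =
  Vec.foldr Deck (λ (s , c) pile → place s c pile) [] (Vec.zip sides deck)

-- The cards shown so far, most recent first.
History : Set
History = List Card

-- The largest of the labels 1, …, k not yet shown; 0, which is not a label,
-- if there is none.
largestUnshown : ℕ → History → Card
largestUnshown zero    shown = 0
largestUnshown (suc k) shown =
  if does (_∈?_ _≟_ (suc k) shown) then largestUnshown k shown else suc k

-- For n = 1 the label n ∸ 1 = 0 is not in the deck, so it is never shown.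
guess : ℕ → History → Card
guess n []          = 1
guess n (c ∷ shown) =
  if does (_∈?_ _≟_ (n ∸ 1) (c ∷ shown) ⊎-dec _∈?_ _≟_ n (c ∷ shown))
  then largestUnshown n (c ∷ shown)
  else suc c

correctGuesses : ∀ {k} → (History → Card) → History → Deck k → ℕ
correctGuesses strategy shown []         = 0
correctGuesses strategy shown (c ∷ deck) =
  (if does (strategy shown ≟ c) then 1 else 0)
    ℕ.+ correctGuesses strategy (c ∷ shown) deck

RandomVariable : ℕ → Set
RandomVariable n = Vec Side n → ℚ

outcomes : ∀ n → List (Vec Side n)
outcomes zero    = [] ∷ []
outcomes (suc n) = List.cartesianProductWith _∷_ (top ∷ bottom ∷ []) (outcomes n)

-- The n sides are independent and fair, so every outcome has probability ½ ^ n.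
𝔼 : ∀ {n} → RandomVariable n → ℚ
𝔼 {n} Y = List.foldr _+_ 0ℚ (List.map (λ ω → ½ ^ n * Y ω) (outcomes n))

𝕍 : ∀ {n} → RandomVariable n → ℚ
𝕍 Y = 𝔼 (λ ω → (Y ω - 𝔼 Y) * (Y ω - 𝔼 Y))

X : ∀ n → RandomVariable n
X n ω = + correctGuesses (guess n) [] (shelfShuffle ω (orderedDeck n)) / 1

{-# OPTIONS --safe #-}

-- Let bᵢ be the side of card i, with b₀ = top.  The shuffled deck lists the
-- cards sent to the top in ascending order, followed by the others in
-- descending order, and card n is the turning point.  Hence a bottom card is
-- always guessed, a top card i < n is guessed iff bᵢ₋₁ = top, and card n is
-- guessed iff bₙ₋₁ = top.  This makes X a function of a two-state Markov chain;
-- its first two moments, taken about an arbitrary point c and for both initial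
-- states, satisfy a linear recursion that is closed because c is arbitrary.
module Submission where

open import Defs
open import Data.Bool using (if_then_else_)
open import Data.Fin using (Fin; toℕ)
open import Data.Integer as ℤ using (+_)
open import Data.Integer.Solver renaming (module +-*-Solver to ℤSolver)
open import Data.List as List using (List; []; _∷_)
open import Data.List.Membership.DecPropositional using (_∈?_)
open import Data.List.Membership.Propositional using (_∈_; _∉_)
import Data.List.Properties as List
open import Data.List.Relation.Unary.All as All using (All; []; _∷_)
open import Data.List.Relation.Unary.All.Properties using (All¬⇒¬Any)
open import Data.List.Relation.Unary.Any using (here; there)
open import Data.Nat as ℕ using (ℕ; zero; suc; _≥_; _≤_; _<_; z≤n; s≤s; _∸_; _≟_)
import Data.Nat.Properties as ℕ
open import Data.Product using (_×_; _,_; proj₁; proj₂)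
open import Data.Rational using (ℚ; 0ℚ; 1ℚ; ½; _+_; _-_; -_; _*_; _/_; toℚᵘ; +-*-rawSemiring)
import Data.Rational.Properties as ℚ
open import Data.Rational.Solver using (module +-*-Solver)
open import Data.Rational.Unnormalised as ℚᵘ using (mkℚᵘ)
import Data.Rational.Unnormalised.Properties as ℚᵘ
open import Data.Sum using (inj₁; inj₂; _⊎_; [_,_]′)
open import Data.Vec as Vec using (Vec; []; _∷_; _∷ʳ_)
open import Data.Vec.Properties using (tabulate-cong)
open import Function using (_∘_; id)
open import Relation.Binary.PropositionalEquality
  using (_≡_; _≢_; refl; sym; trans; cong; cong₂; subst; subst₂; module ≡-Reasoning)
open import Relation.Nullary using (does; contradiction)
open import Relation.Nullary.Decidable using (dec-true; dec-false; _⊎-dec_)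

open import Algebra.Definitions.RawSemiring +-*-rawSemiring using (_^_)

private
  variable
    k n : ℕ
    a c g : Card
    s : Side
    shown : History

-- Evaluating the guesses

hit : Card → Card → ℕ
hit g c = if does (g ≟ c) then 1 else 0

hit-≡ : g ≡ c → hit g c ≡ 1
hit-≡ {g} {c} eq rewrite dec-true (g ≟ c) eq = refl

hit-≢ : g ≢ c → hit g c ≡ 0
hit-≢ {g} {c} neq rewrite dec-false (g ≟ c) neq = refl

largestUnshown-≡ : ∀ k → 1 ≤ a → a ≤ k → a ∉ shown →
                   (∀ {c} → a < c → c ≤ k → c ∈ shown) →
                   largestUnshown k shown ≡ a
largestUnshown-≡ zero 1≤a a≤0 _ _ = contradiction (ℕ.≤-trans 1≤a a≤0) λ ()
largestUnshown-≡ {a} {shown} (suc k) 1≤a a≤1+k a∉ above with ℕ.m≤n⇒m<n∨m≡n a≤1+k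
... | inj₂ refl rewrite dec-false (_∈?_ _≟_ (suc k) shown) a∉ = refl
... | inj₁ (s≤s a≤k) rewrite dec-true (_∈?_ _≟_ (suc k) shown) (above (s≤s a≤k) ℕ.≤-refl) =
  largestUnshown-≡ k 1≤a a≤k a∉ λ a<c c≤k → above a<c (ℕ.m≤n⇒m≤1+n c≤k)

guess-descending : n ∸ 1 ∈ shown ⊎ n ∈ shown → guess n shown ≡ largestUnshown n shown
guess-descending {n} {[]} (inj₁ ())
guess-descending {n} {[]} (inj₂ ())
guess-descending {n} {c ∷ shown} p
  rewrite dec-true (_∈?_ _≟_ (n ∸ 1) (c ∷ shown) ⊎-dec _∈?_ _≟_ n (c ∷ shown)) p = refl

guess-ascending : n ∸ 1 ∉ c ∷ shown → n ∉ c ∷ shown → guess n (c ∷ shown) ≡ suc c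
guess-ascending {n} {c} {shown} p q
  rewrite dec-false (_∈?_ _≟_ (n ∸ 1) (c ∷ shown) ⊎-dec _∈?_ _≟_ n (c ∷ shown)) [ p , q ]′ = refl

-- Shuffling the cards a, a + 1, …

cardsFrom : Card → ∀ k → Deck k
cardsFrom a zero    = []
cardsFrom a (suc k) = a ∷ cardsFrom (suc a) k

tabulate-cardsFrom : ∀ a k → Vec.tabulate (λ (i : Fin k) → a ℕ.+ toℕ i) ≡ cardsFrom a k
tabulate-cardsFrom a zero    = refl
tabulate-cardsFrom a (suc k) = cong₂ _∷_ (ℕ.+-identityʳ a)
  (trans (tabulate-cong (λ i → ℕ.+-suc a (toℕ i))) (tabulate-cardsFrom (suc a) k))

pileFrom : Card → Vec Side k → Deck k
pileFrom {k} a ω = shelfShuffle ω (cardsFrom a k)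

reveal : History → Deck k → History
reveal shown []         = shown
reveal shown (c ∷ deck) = reveal (c ∷ shown) deck

reveal-∷ʳ : ∀ (deck : Deck k) → reveal shown (deck ∷ʳ a) ≡ a ∷ reveal shown deck
reveal-∷ʳ []         = refl
reveal-∷ʳ (c ∷ deck) = reveal-∷ʳ deck

∈-reveal : ∀ (deck : Deck k) → c ∈ shown → c ∈ reveal shown deck
∈-reveal []         p = p
∈-reveal (_ ∷ deck) p = ∈-reveal deck (there p)

∈-reveal-pileFrom : ∀ (ω : Vec Side k) → a ≤ c → c < a ℕ.+ k → c ∈ reveal shown (pileFrom a ω)
∈-reveal-pileFrom {a = a} [] a≤c c<a =
  contradiction a≤c (ℕ.<⇒≱ (subst (_ <_) (ℕ.+-identityʳ a) c<a))
∈-reveal-pileFrom {suc k} {a} {c} {shown} (s ∷ ω) a≤c c<a+k with ℕ.m≤n⇒m<n∨m≡n a≤c | s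
... | inj₂ refl | top    = ∈-reveal (pileFrom (suc a) ω) (here refl)
... | inj₂ refl | bottom rewrite reveal-∷ʳ {shown = shown} {a} (pileFrom (suc a) ω) = here refl
... | inj₁ a<c  | top    = ∈-reveal-pileFrom ω a<c (subst (c <_) (ℕ.+-suc a k) c<a+k)
... | inj₁ a<c  | bottom rewrite reveal-∷ʳ {shown = shown} {a} (pileFrom (suc a) ω) =
  there (∈-reveal-pileFrom ω a<c (subst (c <_) (ℕ.+-suc a k) c<a+k))

-- Applied to the predicate `a ≢_`, this shows that a bottom card `a` is still unshown once all
-- larger cards are drawn.
All-reveal-pileFrom : ∀ {P : Card → Set} (ω : Vec Side k) → All P shown →
                      (∀ {c} → a ≤ c → P c) → All P (reveal shown (pileFrom a ω))
All-reveal-pileFrom []           ps p = ps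
All-reveal-pileFrom (top ∷ ω)    ps p = All-reveal-pileFrom ω (p ℕ.≤-refl ∷ ps) (p ∘ ℕ.<⇒≤)
All-reveal-pileFrom {shown = shown} {a} (bottom ∷ ω) ps p
  rewrite reveal-∷ʳ {shown = shown} {a} (pileFrom (suc a) ω) =
  p ℕ.≤-refl ∷ All-reveal-pileFrom ω ps (p ∘ ℕ.<⇒≤)

-- Serves the cards sent to the bottom: such a card lies beneath all larger ones, so it is guessed
-- with their whole pile in the history.
correctGuesses-∷ʳ : ∀ strategy shown (deck : Deck k) →
  correctGuesses strategy shown (deck ∷ʳ a) ≡
  correctGuesses strategy shown deck ℕ.+ hit (strategy (reveal shown deck)) a
correctGuesses-∷ʳ strategy shown []         = ℕ.+-identityʳ _
correctGuesses-∷ʳ {a = a} strategy shown (c ∷ deck)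
  rewrite correctGuesses-∷ʳ {a = a} strategy (c ∷ shown) deck =
  sym (ℕ.+-assoc (hit (strategy shown) c) _ _)

<⇒∉ : All (_< c) shown → c ∉ shown
<⇒∉ p = All¬⇒¬Any (All.map ℕ.>⇒≢ p)

-- As `ω` is nonempty, card `n` is among the larger cards drawn before `a`, so the descending phase
-- has begun. Everything above `a` is shown and `a` is not, so `a` is the largest card left.
guess-last : ∀ a (ω : Vec Side (suc k)) → 1 ≤ a → a ℕ.+ suc k ≡ n → All (_< a) shown →
             guess n (reveal shown (pileFrom (suc a) ω)) ≡ a
guess-last {k} {n} a ω 1≤a eq below = trans
  (guess-descending (inj₂ (above a<n ℕ.≤-refl)))
  (largestUnshown-≡ n 1≤a (ℕ.<⇒≤ a<n)
    (All¬⇒¬Any (All-reveal-pileFrom ω (All.map ℕ.>⇒≢ below) ℕ.<⇒≢))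
    above)
  where
  a<n : a < n
  a<n = subst (a <_) eq (ℕ.m<m+n a ℕ.z<s)
  above : ∀ {c} → a < c → c ≤ n → c ∈ reveal _ (pileFrom (suc a) ω)
  above a<c c≤n = ∈-reveal-pileFrom ω a<c (s≤s (subst (_ ≤_) (sym eq) c≤n))

-- The score as a function of the sides

-- Follows s a shown: the cards shown are the top cards below a, and s is the
-- side of card a − 1, where the nonexistent card 0 counts as a top card.
data Follows : Side → Card → History → Set where
  start    : Follows top 1 []
  adjacent : All (_≤ c) shown → Follows top (suc c) (c ∷ shown)
  gap      : 1 ≤ a → All (_< a) shown → Follows bottom (suc a) shown

Follows⇒< : Follows s a shown → All (_< a) shown
Follows⇒< start        = []
Follows⇒< (adjacent p) = s≤s ℕ.≤-refl ∷ All.map s≤s p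
Follows⇒< (gap _ p)    = All.map ℕ.m≤n⇒m≤1+n p

Follows⇒1≤ : Follows s a shown → 1 ≤ a
Follows⇒1≤ start        = s≤s z≤n
Follows⇒1≤ (adjacent _) = s≤s z≤n
Follows⇒1≤ (gap _ _)    = s≤s z≤n

follow-top : Follows s a shown → Follows top (suc a) (a ∷ shown)
follow-top f = adjacent (All.map ℕ.<⇒≤ (Follows⇒< f))

follow-bottom : Follows s a shown → Follows bottom (suc a) shown
follow-bottom f = gap (Follows⇒1≤ f) (Follows⇒< f)

point : Side → ℕ
point top    = 1
point bottom = 0

-- If card `a - 1` went to the top, it was shown last and its successor is guessed. If it went to
-- the bottom, the last card shown, if any, is smaller than `a - 1`, and its successor falls short
-- of `a`.
hit-Follows : Follows s a shown → a ≤ n → hit (guess n shown) a ≡ point s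
hit-Follows start _ = refl
hit-Follows {shown = shown} {n} f@(adjacent {c} p) a≤n with ℕ.m≤n⇒m<n∨m≡n a≤n
-- Card `n - 1` has just been shown, so the descending phase has begun, but it opens with `n`
-- itself.
... | inj₂ refl = hit-≡ {guess n shown} {n} (trans
  (guess-descending {n} (inj₁ (here refl)))
  (largestUnshown-≡ n (s≤s z≤n) ℕ.≤-refl (<⇒∉ (Follows⇒< f))
    λ n<c c≤n → contradiction c≤n (ℕ.<⇒≱ n<c)))
... | inj₁ a<n@(s≤s a≤n-1) = hit-≡ {guess n shown} {suc c} (guess-ascending {n}
  (<⇒∉ (All.map (λ q → ℕ.≤-trans q a≤n-1) (Follows⇒< f)))
  (<⇒∉ (All.map (λ q → ℕ.<-trans q a<n) (Follows⇒< f))))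
hit-Follows (gap {a} 1≤a []) _ = hit-≢ {1} {suc a} λ { refl → contradiction 1≤a λ () }
-- All shown cards are below `a`, so the guess is still ascending even when the current card `suc a`
-- is the last one.
hit-Follows {n = suc n} (gap {a} {c ∷ shown} 1≤a p@(c<a ∷ _)) (s≤s a≤n) =
  hit-≢ {guess (suc n) (c ∷ shown)} {suc a} λ eq → ℕ.<⇒≢ c<a (ℕ.suc-injective (trans
    (sym (guess-ascending {suc n}
      (<⇒∉ (All.map (λ q → ℕ.≤-trans q a≤n) p))
      (<⇒∉ (All.map (λ q → ℕ.m≤n⇒m≤1+n (ℕ.≤-trans q a≤n)) p))))
    eq))

-- The last card is placed on an empty pile, where both sides give the same deck; it scores like a
-- top card.
score : Side → Vec Side k → ℕ
score s []                   = 0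
score s (_ ∷ [])             = point s
score s (top ∷ ω@(_ ∷ _))    = point s ℕ.+ score top ω
score s (bottom ∷ ω@(_ ∷ _)) = suc (score bottom ω)

-- Induction on the cards: a top card is drawn before the pile of larger cards, a bottom card after
-- it.
correctGuesses-score : ∀ (ω : Vec Side (suc k)) → Follows s a shown → a ℕ.+ k ≡ n →
                       correctGuesses (guess n) shown (pileFrom a ω) ≡ score s ω
correctGuesses-score {a = a} (top ∷ []) f eq =
  trans (ℕ.+-identityʳ _) (hit-Follows f (subst (a ≤_) eq (ℕ.m≤m+n a _)))
correctGuesses-score {a = a} (bottom ∷ []) f eq =
  trans (ℕ.+-identityʳ _) (hit-Follows f (subst (a ≤_) eq (ℕ.m≤m+n a _)))
correctGuesses-score {suc k} {a = a} (top ∷ ω@(_ ∷ _)) f eq = cong₂ ℕ._+_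
  (hit-Follows f (subst (a ≤_) eq (ℕ.m≤m+n a _)))
  (correctGuesses-score ω (follow-top f) (trans (sym (ℕ.+-suc a k)) eq))
correctGuesses-score {suc k} {s} {a} {shown} {n} (bottom ∷ ω@(_ ∷ _)) f eq = begin
  correctGuesses (guess n) shown (pileFrom (suc a) ω ∷ʳ a)
    ≡⟨ correctGuesses-∷ʳ (guess n) shown (pileFrom (suc a) ω) ⟩
  correctGuesses (guess n) shown (pileFrom (suc a) ω)
    ℕ.+ hit (guess n (reveal shown (pileFrom (suc a) ω))) a
    ≡⟨ cong₂ ℕ._+_
         (correctGuesses-score ω (follow-bottom f) (trans (sym (ℕ.+-suc a k)) eq))
         (hit-≡ (guess-last a ω (Follows⇒1≤ f) eq (Follows⇒< f))) ⟩
  score bottom ω ℕ.+ 1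
    ≡⟨ ℕ.+-comm _ 1 ⟩
  suc (score bottom ω) ∎
  where open ≡-Reasoning

ι : ℕ → ℚ
ι m = + m / 1

X-score : ∀ (ω : Vec Side (suc k)) → X (suc k) ω ≡ ι (score top ω)
X-score {k} ω = cong ι (trans
  (cong (correctGuesses (guess (suc k)) [] ∘ shelfShuffle ω) (tabulate-cardsFrom 1 (suc k)))
  (correctGuesses-score ω start refl))

-- Expectations

sumOver : ∀ {A : Set} → (A → ℚ) → List A → ℚ
sumOver f xs = List.foldr _+_ 0ℚ (List.map f xs)

sumOver-++ : ∀ {A : Set} (f : A → ℚ) xs ys →
             sumOver f (xs List.++ ys) ≡ sumOver f xs + sumOver f ys
sumOver-++ f []       ys = sym (ℚ.+-identityˡ _)
sumOver-++ f (x ∷ xs) ys =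
  trans (cong (λ y → f x + y) (sumOver-++ f xs ys)) (sym (ℚ.+-assoc (f x) _ _))

sumOver-map-* : ∀ {A B : Set} (h : A → B) {f : B → ℚ} {g : A → ℚ} q →
                (∀ x → f (h x) ≡ q * g x) → ∀ xs → sumOver f (List.map h xs) ≡ q * sumOver g xs
sumOver-map-* h q eq []       = sym (ℚ.*-zeroʳ q)
sumOver-map-* h q eq (x ∷ xs) =
  trans (cong₂ _+_ (eq x) (sumOver-map-* h q eq xs)) (sym (ℚ.*-distribˡ-+ q _ _))

𝔼-cong : {Y Z : RandomVariable n} → (∀ ω → Y ω ≡ Z ω) → 𝔼 Y ≡ 𝔼 Z
𝔼-cong {n} eq =
  cong (List.foldr _+_ 0ℚ) (List.map-cong (λ ω → cong (½ ^ n *_) (eq ω)) (outcomes n))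

𝔼-[] : (Y : RandomVariable 0) → 𝔼 Y ≡ Y []
𝔼-[] Y = trans (ℚ.+-identityʳ _) (ℚ.*-identityˡ _)

-- Conditioning on the side of the first card.
𝔼-suc : (Y : RandomVariable (suc n)) →
        𝔼 Y ≡ ½ * (𝔼 (λ ω → Y (top ∷ ω)) + 𝔼 (λ ω → Y (bottom ∷ ω)))
𝔼-suc {n} Y = begin
  sumOver weighted (tops List.++ bottoms List.++ [])
    ≡⟨ cong (λ xs → sumOver weighted (tops List.++ xs)) (List.++-identityʳ bottoms) ⟩
  sumOver weighted (tops List.++ bottoms)
    ≡⟨ sumOver-++ weighted tops bottoms ⟩
  sumOver weighted tops + sumOver weighted bottoms
    ≡⟨ cong₂ _+_ (half top) (half bottom) ⟩
  ½ * 𝔼 (λ ω → Y (top ∷ ω)) + ½ * 𝔼 (λ ω → Y (bottom ∷ ω))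
    ≡⟨ ℚ.*-distribˡ-+ ½ (𝔼 (λ ω → Y (top ∷ ω))) (𝔼 (λ ω → Y (bottom ∷ ω))) ⟨
  ½ * (𝔼 (λ ω → Y (top ∷ ω)) + 𝔼 (λ ω → Y (bottom ∷ ω))) ∎
  where
  open ≡-Reasoning
  weighted : Vec Side (suc n) → ℚ
  weighted ω = ½ ^ suc n * Y ω
  tops    = List.map (top ∷_) (outcomes n)
  bottoms = List.map (bottom ∷_) (outcomes n)
  half : ∀ s → sumOver weighted (List.map (s ∷_) (outcomes n)) ≡ ½ * 𝔼 (λ ω → Y (s ∷ ω))
  half s = sumOver-map-* (s ∷_) ½ (λ ω → ℚ.*-assoc ½ (½ ^ n) (Y (s ∷ ω))) (outcomes n)

-- Moments of the score

-- Since `_/_` reduces fractions, the identity is checked by cross-multiplication in the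
-- unnormalised rationals.
+-/-homo : ∀ i j d .{{_ : ℕ.NonZero d}} → (i ℤ.+ j) / d ≡ i / d + j / d
+-/-homo i j d@(suc d-1) = ℚ.toℚᵘ-injective (begin-equality
  toℚᵘ ((i ℤ.+ j) / d)
    ≃⟨ ℚ.toℚᵘ-fromℚᵘ (mkℚᵘ (i ℤ.+ j) d-1) ⟩
  mkℚᵘ (i ℤ.+ j) d-1
    ≃⟨ ℚᵘ.*≡* (solve 3 (λ i j d → (i :+ j) :* (d :* d) := (i :* d :+ j :* d) :* d)
                       refl i j (+ d)) ⟩
  mkℚᵘ i d-1 ℚᵘ.+ mkℚᵘ j d-1
    ≃⟨ ℚᵘ.+-cong (ℚ.toℚᵘ-fromℚᵘ (mkℚᵘ i d-1)) (ℚ.toℚᵘ-fromℚᵘ (mkℚᵘ j d-1)) ⟨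
  toℚᵘ (i / d) ℚᵘ.+ toℚᵘ (j / d)
    ≃⟨ ℚ.toℚᵘ-homo-+ (i / d) (j / d) ⟨
  toℚᵘ (i / d + j / d) ∎)
  where
  open ℚᵘ.≤-Reasoning
  open ℤSolver

open +-*-Solver

-- The shift `c` collects the points already scored; for the variance it also centres the score at
-- its mean.
moment : (ℚ → ℚ) → Side → ℕ → ℚ → ℚ
moment f s n c = 𝔼 {n} (λ ω → f (c + ι (score s ω)))

half-sum : ℚ → ℚ → ℚ
half-sum x y = ½ * (x + y)

moment-1 : ∀ f s c → moment f s 1 c ≡ f (c + ι (point s))
moment-1 f s c = begin
  moment f s 1 c
    ≡⟨ 𝔼-suc Y ⟩
  half-sum (𝔼 (λ ω → Y (top ∷ ω))) (𝔼 (λ ω → Y (bottom ∷ ω)))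
    ≡⟨ cong₂ half-sum (𝔼-[] (λ ω → Y (top ∷ ω))) (𝔼-[] (λ ω → Y (bottom ∷ ω))) ⟩
  half-sum (f (c + ι (point s))) (f (c + ι (point s)))
    ≡⟨ solve 1 (λ x → con ½ :* (x :+ x) := x) refl (f (c + ι (point s))) ⟩
  f (c + ι (point s)) ∎
  where
  open ≡-Reasoning
  Y : RandomVariable 1
  Y ω = f (c + ι (score s ω))

-- One step of the chain: the point earned by the first card moves into the shift, and that card's
-- side becomes the new state.
moment-suc : ∀ f s k c → moment f s (2 ℕ.+ k) c ≡
  half-sum (moment f top (suc k) (c + ι (point s))) (moment f bottom (suc k) (c + 1ℚ))
moment-suc f s k c = trans (𝔼-suc Y) (cong₂ half-sum
  (𝔼-cong {Y = λ ω → Y (top ∷ ω)}    λ { ω@(_ ∷ _) → cong f (shift (point s) (score top ω)) })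
  (𝔼-cong {Y = λ ω → Y (bottom ∷ ω)} λ { ω@(_ ∷ _) → cong f (shift 1 (score bottom ω)) }))
  where
  Y : RandomVariable (2 ℕ.+ k)
  Y ω = f (c + ι (score s ω))
  shift : ∀ i j → c + ι (i ℕ.+ j) ≡ (c + ι i) + ι j
  shift i j = trans (cong (λ x → c + x) (+-/-homo (+ i) (+ j) 1))
                    (sym (ℚ.+-assoc c (ι i) (ι j)))

moment-2 : ∀ f s c → moment f s 2 c ≡
           half-sum (f (c + ι (point s) + 1ℚ)) (f (c + 1ℚ + 0ℚ))
moment-2 f s c = trans (moment-suc f s 0 c)
  (cong₂ half-sum (moment-1 f top (c + ι (point s))) (moment-1 f bottom (c + 1ℚ)))

-- Closed forms of the moments

¾ ¼ 1/16 : ℚ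
¾ = + 3 / 4
¼ = + 1 / 4
1/16 = + 1 / 16

square : ℚ → ℚ
square x = x * x

-- For at least two cards, the initial state `bottom` costs one point exactly when the first card
-- goes to the top, hence the offset `½`. For one card the offset would be 1, so the induction
-- starts at two.
FirstMoments : ℕ → ℚ → Set
FirstMoments n μ = ∀ c → moment id top n c ≡ c + μ × moment id bottom n c ≡ c + μ - ½

-- v and w are the variances of the score for the two initial states.
SecondMoments : ℕ → ℚ → ℚ → ℚ → Set
SecondMoments n μ v w = ∀ c →
  moment square top n c ≡ square (c + μ) + v ×
  moment square bottom n c ≡ square (c + μ - ½) + w

firstMoments-2 : FirstMoments 2 (¾ * ι 2)
firstMoments-2 c =
  trans (moment-2 id top c)
  (solve 1 (λ c → con ½ :* ((c :+ con 1ℚ :+ con 1ℚ) :+ (c :+ con 1ℚ :+ con 0ℚ))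
                  := c :+ con (¾ * ι 2)) refl c) ,
  trans (moment-2 id bottom c)
  (solve 1 (λ c → con ½ :* ((c :+ con 0ℚ :+ con 1ℚ) :+ (c :+ con 1ℚ :+ con 0ℚ))
                  := c :+ con (¾ * ι 2) :- con ½) refl c)

-- From `top` the score is 2 or 1, with variance `¼`; from `bottom` it is always 1.
secondMoments-2 : SecondMoments 2 (¾ * ι 2) ¼ 0ℚ
secondMoments-2 c =
  trans (moment-2 square top c)
  (solve 1 (λ c → let sq = λ x → x :* x in
     con ½ :* (sq (c :+ con 1ℚ :+ con 1ℚ) :+ sq (c :+ con 1ℚ :+ con 0ℚ))
     := sq (c :+ con (¾ * ι 2)) :+ con ¼) refl c) ,
  trans (moment-2 square bottom c)
  (solve 1 (λ c → let sq = λ x → x :* x in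
     con ½ :* (sq (c :+ con 0ℚ :+ con 1ℚ) :+ sq (c :+ con 1ℚ :+ con 0ℚ))
     := sq (c :+ con (¾ * ι 2) :- con ½) :+ con 0ℚ) refl c)

firstMoments-suc : ∀ {μ} → FirstMoments (suc k) μ → FirstMoments (2 ℕ.+ k) (μ + ¾)
firstMoments-suc {k} {μ} first c =
  trans (step top)
  (solve 2 (λ c μ → con ½ :* ((c :+ con 1ℚ :+ μ) :+ (c :+ con 1ℚ :+ μ :- con ½))
                    := c :+ (μ :+ con ¾)) refl c μ) ,
  trans (step bottom)
  (solve 2 (λ c μ → con ½ :* ((c :+ con 0ℚ :+ μ) :+ (c :+ con 1ℚ :+ μ :- con ½))
                    := c :+ (μ :+ con ¾) :- con ½) refl c μ)
  where
  step : ∀ s → moment id s (2 ℕ.+ k) c ≡ half-sum (c + ι (point s) + μ) (c + 1ℚ + μ - ½)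
  step s = trans (moment-suc id s k c)
    (cong₂ half-sum (proj₁ (first (c + ι (point s)))) (proj₂ (first (c + 1ℚ))))

-- Law of total variance: the conditional variances average to `half-sum v w`, and for either
-- initial state the two conditional means differ by `½`, which contributes `1/16`.
secondMoments-suc : ∀ {μ v w} → SecondMoments (suc k) μ v w →
                    SecondMoments (2 ℕ.+ k) (μ + ¾) (half-sum v w + 1/16) (half-sum v w + 1/16)
secondMoments-suc {k} {μ} {v} {w} second c =
  trans (step top)
  (solve 4 (λ c μ v w → let sq = λ x → x :* x in
     con ½ :* ((sq (c :+ con 1ℚ :+ μ) :+ v) :+ (sq (c :+ con 1ℚ :+ μ :- con ½) :+ w))
     := sq (c :+ (μ :+ con ¾)) :+ (con ½ :* (v :+ w) :+ con 1/16)) refl c μ v w) ,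
  trans (step bottom)
  (solve 4 (λ c μ v w → let sq = λ x → x :* x in
     con ½ :* ((sq (c :+ con 0ℚ :+ μ) :+ v) :+ (sq (c :+ con 1ℚ :+ μ :- con ½) :+ w))
     := sq (c :+ (μ :+ con ¾) :- con ½) :+ (con ½ :* (v :+ w) :+ con 1/16)) refl c μ v w)
  where
  step : ∀ s → moment square s (2 ℕ.+ k) c ≡
    half-sum (square (c + ι (point s) + μ) + v) (square (c + 1ℚ + μ - ½) + w)
  step s = trans (moment-suc square s k c)
    (cong₂ half-sum (proj₁ (second (c + ι (point s)))) (proj₂ (second (c + 1ℚ))))

¾*ι-suc : ∀ n → ¾ * ι n + ¾ ≡ ¾ * ι (suc n)
¾*ι-suc n = trans
  (solve 1 (λ x → con ¾ :* x :+ con ¾ := con ¾ :* (con 1ℚ :+ x)) refl (ι n))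
  (cong (¾ *_) (sym (+-/-homo (+ 1) (+ n) 1)))

firstMoments : ∀ k → FirstMoments (2 ℕ.+ k) (¾ * ι (2 ℕ.+ k))
firstMoments zero    = firstMoments-2
firstMoments (suc k) = subst (FirstMoments (3 ℕ.+ k)) (¾*ι-suc (2 ℕ.+ k))
  (firstMoments-suc {suc k} (firstMoments k))

secondMoments : ∀ k → let v = + (3 ℕ.+ k) / 16 in
                SecondMoments (3 ℕ.+ k) (¾ * ι (3 ℕ.+ k)) v v
-- After one step from `¼` and `0ℚ` both variances equal 3/16; from then on each card adds `1/16`.
secondMoments zero    = secondMoments-suc {1} {¾ * ι 2} {¼} {0ℚ} secondMoments-2
secondMoments (suc k) =
  subst₂ (λ μ v → SecondMoments (4 ℕ.+ k) μ v v) (¾*ι-suc (3 ℕ.+ k)) variance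
  (secondMoments-suc {suc (suc k)} {v = v} (secondMoments k))
  where
  v : ℚ
  v = + (3 ℕ.+ k) / 16
  variance : half-sum v v + 1/16 ≡ + (4 ℕ.+ k) / 16
  variance = trans
    (solve 1 (λ v → con ½ :* (v :+ v) :+ con 1/16 := con 1/16 :+ v) refl v)
    (sym (+-/-homo (+ 1) (+ (3 ℕ.+ k)) 16))

-- Expectation and variance of the number of correct guesses

𝔼-X : ∀ k → 𝔼 (X (2 ℕ.+ k)) ≡ ¾ * ι (2 ℕ.+ k)
𝔼-X k = begin
  𝔼 (X (2 ℕ.+ k))
    ≡⟨ 𝔼-cong {2 ℕ.+ k} (λ ω → trans (X-score ω) (sym (ℚ.+-identityˡ _))) ⟩
  moment id top (2 ℕ.+ k) 0ℚ
    ≡⟨ proj₁ (firstMoments k 0ℚ) ⟩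
  0ℚ + ¾ * ι (2 ℕ.+ k)
    ≡⟨ ℚ.+-identityˡ _ ⟩
  ¾ * ι (2 ℕ.+ k) ∎
  where open ≡-Reasoning

𝕍-X : ∀ k → 𝕍 (X (3 ℕ.+ k)) ≡ + (3 ℕ.+ k) / 16
𝕍-X k = begin
  𝕍 (X (3 ℕ.+ k))
    ≡⟨ 𝔼-cong {3 ℕ.+ k} (λ ω → cong square (trans
         (cong₂ _-_ (X-score ω) (𝔼-X (suc k))) (ℚ.+-comm (ι (score top ω)) (- μ)))) ⟩
  -- The variance is the second moment with shift `- μ`.
  moment square top (3 ℕ.+ k) (- μ)
    ≡⟨ proj₁ (secondMoments k (- μ)) ⟩
  square (- μ + μ) + v
    ≡⟨ cong (λ x → square x + v) (ℚ.+-inverseˡ μ) ⟩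
  0ℚ + v
    ≡⟨ ℚ.+-identityˡ v ⟩
  v ∎
  where
  open ≡-Reasoning
  μ v : ℚ
  μ = ¾ * ι (3 ℕ.+ k)
  v = + (3 ℕ.+ k) / 16

theorem4 : ((n : ℕ) → n ≥ 2 → 𝔼 (X n) ≡ (+ 3 / 4) * (+ n / 1)) ×
    𝔼 (X 1) ≡ 1ℚ ×
    ((n : ℕ) → n ≥ 3 → 𝕍 (X n) ≡ + n / 16) ×
    𝕍 (X 1) ≡ 0ℚ ×
    𝕍 (X 2) ≡ + 1 / 4
theorem4 =
  (λ { (suc (suc k)) _ → 𝔼-X k ; (suc zero) (s≤s ()) }) ,
  -- The values for one and two cards are computed by enumerating the outcomes.
  refl ,
  (λ { (suc (suc (suc k))) _ → 𝕍-X k ; (suc (suc zero)) (s≤s (s≤s ())) ; (suc zero) (s≤s ()) }) ,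
  refl ,
  refl
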